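{- Let $\mathcal{R}$ be any relation on processes with $\simeq\;\subseteq\mathcal{R}\subseteq\;\approx$ (branching bisimilarity contained in $\mathcal{R}$, contained in weak bisimilarity). Then the following problem is undecidable: given a normed one counter net and two of its processes $P,Q$, decide whether $P\,\mathcal{R}\,Q$.
   Context: A one counter net is a tuple $(\mathcal{Q},X,\mathcal{A},\Delta)$ where $\mathcal{Q}$ is a finite set of states, $X$ is a place, $\mathcal{A}$ is a finite set of actions containing a special silent action $\tau$, and $\Delta$ is a finite set of rules of the form $pX^{i}\stackrel{\ell}{\longrightarrow}qX^{j}$ with $i\in\{0,1\}$, $j\ge 0$, $\ell\in\mathcal{A}$. Processes are $pX^{n}$ ($p$ a state, $n\ge 0$ the number of tokens). Semantics: $pX^{i+k}\stackrel{\ell}{\longrightarrow}qX^{j+k}$ for all $k\ge0$ whenever $pX^{i}\stackrel{\ell}{\longrightarrow}qX^{j}\in\Delta$. A process $P$ is normed if there are actions $\ell_1,\dots,\ell_m$ and a state $p$ with $P\stackrel{\ell_1}{\longrightarrow}\cdots\stackrel{\ell_m}{\longrightarrow}p$ (i.e. $pX^0$) and $p$ has no outgoing transition; the net is normed if all its processes are normed. Write $\Longrightarrow$ for the reflexive transitive closure of $\stackrel{\tau}{\longrightarrow}$, and $\stackrel{\widehat{\ell}}{\Longrightarrow}$ for $\Longrightarrow\stackrel{\ell}{\longrightarrow}\Longrightarrow$ if $\ell\neq\tau$ and for $\Longrightarrow$ if $\ell=\tau$. A relation $\mathcal{B}$ is a weak bisimulation if whenever $P\mathcal{B}Q$ and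 $P\stackrel{\ell}{\longrightarrow}P'$ there is $Q'$ with $Q\stackrel{\widehat{\ell}}{\Longrightarrow}Q'$ and $P'\mathcal{B}Q'$, and symmetrically for moves of $Q$; $\approx$ is the largest weak bisimulation. A relation $\mathcal{B}$ is a branching bisimulation if whenever $P\mathcal{B}Q$ and $P\stackrel{\ell}{\longrightarrow}P'$, either (i) $Q\Longrightarrow Q''\stackrel{\ell}{\longrightarrow}Q'$ with $P\mathcal{B}Q''$ and $P'\mathcal{B}Q'$, or (ii) $\ell=\tau$ and $P'\mathcal{B}Q$; and symmetrically for moves of $Q$. $\simeq$ is the largest branching bisimulation. -}

module Defs where

open import Data.Bool using (Bool)
open import Data.Fin using (Fin; zero; suc; toℕ)
open import Data.List using (List; []; _∷_; map)
open import Data.List.Membership.Propositional using (_∈_)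
open import Data.Nat using (ℕ; zero; suc; _+_; _*_; _^_)
open import Data.Product using (Σ-syntax; ∃-syntax; _×_)
open import Data.Sum using (_⊎_)
open import Data.Vec using (Vec; []; _∷_; _++_; lookup; replicate; _[_]%=_; _[_]≔_)
open import Function using (flip)
open import Level using (Level; 0ℓ)
open import Relation.Binary using (Rel)
open import Relation.Binary.Construct.Closure.ReflexiveTransitive using (Star)
open import Relation.Binary.PropositionalEquality using (_≡_)
open import Relation.Nullary using (¬_; Reflects)

------------------------------------------------------------------------
-- One counter nets

-- rule src i ℓ tgt j  stands for  src Xⁱ —ℓ→ tgt Xʲ.
record Rule (states actions : ℕ) : Set where
  constructor rule
  field
    source  : Fin states
    consume : Fin 2
    label   : Fin actions
    target  : Fin states
    produce : ℕ

-- There are `visible` actions besides the silent one, which is always the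
-- action `zero`.
record Net : Set where
  constructor net
  field
    states  : ℕ
    visible : ℕ
    rules   : List (Rule states (suc visible))

  State : Set
  State = Fin states

  Action : Set
  Action = Fin (suc visible)

open Net public using (State; Action)

record Process (N : Net) : Set where
  constructor _X^_
  field
    state  : State N
    tokens : ℕ

module Semantics (N : Net) where

  open Net N using (rules)

  τ : Action N
  τ = zero

  infix 4 _—[_]→_ _—→*_ _⇒_ _⇒̂[_]_

  data _—[_]→_ : Process N → Action N → Process N → Set where
    fire : ∀ {p i ℓ q j} → rule p i ℓ q j ∈ rules → (k : ℕ) →
           (p X^ (toℕ i + k)) —[ ℓ ]→ (q X^ (j + k))

  _—→*_ : Rel (Process N) 0ℓ
  _—→*_ = Star (λ P P′ → ∃[ ℓ ] (P —[ ℓ ]→ P′))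

  Stuck : Process N → Set
  Stuck P = ∀ ℓ P′ → ¬ (P —[ ℓ ]→ P′)

  NormedProcess : Process N → Set
  NormedProcess P = ∃[ p ] ((P —→* (p X^ 0)) × Stuck (p X^ 0))

  _⇒_ : Rel (Process N) 0ℓ
  _⇒_ = Star (_—[ τ ]→_)

  _⇒̂[_]_ : Process N → Action N → Process N → Set
  P ⇒̂[ zero      ] Q = P ⇒ Q
  P ⇒̂[ ℓ@(suc _) ] Q = ∃[ P′ ] ∃[ Q′ ] ((P ⇒ P′) × (P′ —[ ℓ ]→ Q′) × (Q′ ⇒ Q))

  WeakSimulation : Rel (Process N) 0ℓ → Set
  WeakSimulation B = ∀ {P Q ℓ P′} → B P Q → P —[ ℓ ]→ P′ →
    ∃[ Q′ ] ((Q ⇒̂[ ℓ ] Q′) × B P′ Q′)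

  WeakBisimulation : Rel (Process N) 0ℓ → Set
  WeakBisimulation B = WeakSimulation B × WeakSimulation (flip B)

  BranchingSimulation : Rel (Process N) 0ℓ → Set
  BranchingSimulation B = ∀ {P Q ℓ P′} → B P Q → P —[ ℓ ]→ P′ →
    (∃[ Q″ ] ∃[ Q′ ] ((Q ⇒ Q″) × (Q″ —[ ℓ ]→ Q′) × B P Q″ × B P′ Q′))
    ⊎ (ℓ ≡ τ × B P′ Q)

  BranchingBisimulation : Rel (Process N) 0ℓ → Set
  BranchingBisimulation B = BranchingSimulation B × BranchingSimulation (flip B)

Normed : Net → Set
Normed N = ∀ (P : Process N) → Semantics.NormedProcess N P

-- The largest bisimulations, as the unions of all bisimulations.

WeaklyBisimilar : (N : Net) → Process N → Process N → Set₁
WeaklyBisimilar N P Q =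
  Σ[ B ∈ Rel (Process N) 0ℓ ] (Semantics.WeakBisimulation N B × B P Q)

BranchingBisimilar : (N : Net) → Process N → Process N → Set₁
BranchingBisimilar N P Q =
  Σ[ B ∈ Rel (Process N) 0ℓ ] (Semantics.BranchingBisimulation N B × B P Q)

------------------------------------------------------------------------
-- Algorithms: register (Minsky) machines that accept or reject

data Instruction (registers lines : ℕ) : Set where
  halt : Bool → Instruction registers lines
  inc  : Fin registers → Fin lines → Instruction registers lines
  -- dec r l l′: if register r is positive, decrement it and go to l;
  -- otherwise go to l′.
  dec  : Fin registers → Fin lines → Fin lines → Instruction registers lines

Program : ℕ → ℕ → Set
Program registers lines = Vec (Instruction registers lines) lines

-- prog ⊢ l , v ⇓ b : started at line l with register contents v, the
-- program eventually halts with answer b.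
data _⊢_,_⇓_ {registers lines} (prog : Program registers lines) :
     Fin lines → Vec ℕ registers → Bool → Set where
  halt     : ∀ {l v b} → lookup prog l ≡ halt b → prog ⊢ l , v ⇓ b
  inc      : ∀ {l v b r l₁} → lookup prog l ≡ inc r l₁ →
             prog ⊢ l₁ , v [ r ]%= suc ⇓ b → prog ⊢ l , v ⇓ b
  dec-suc  : ∀ {l v b r l₁ l₂ c} → lookup prog l ≡ dec r l₁ l₂ →
             lookup v r ≡ suc c →
             prog ⊢ l₁ , v [ r ]≔ c ⇓ b → prog ⊢ l , v ⇓ b
  dec-zero : ∀ {l v b r l₁ l₂} → lookup prog l ≡ dec r l₁ l₂ →
             lookup v r ≡ 0 →
             prog ⊢ l₂ , v ⇓ b → prog ⊢ l , v ⇓ b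

-- A machine with k inputs has any number of further work registers,
-- initially 0; it starts at its first line.
record Machine (k : ℕ) : Set where
  field
    work    : ℕ
    size    : ℕ
    program : Program (k + work) (suc size)

  Answers : Vec ℕ k → Bool → Set
  Answers xs b = program ⊢ zero , xs ++ replicate work 0 ⇓ b

-- The problem "given x : I, does A x hold?", where instances are presented
-- to machines as tuples of k numbers. I may be restricted by a promise:
-- nothing is required on tuples that encode no instance.
AlgorithmicallyDecidable : ∀ {i a : Level} {I : Set i} {k : ℕ} →
  (I → Vec ℕ k) → (I → Set a) → Set _
AlgorithmicallyDecidable {I = I} {k = k} encode A =
  Σ[ M ∈ Machine k ] (∀ (x : I) → ∃[ b ] (Machine.Answers M (encode x) b × Reflects (A x) b))

------------------------------------------------------------------------
-- Instances of the equivalence problem and their Gödel numbering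

-- A bijection between List ℕ and ℕ: every positive number is 2ˣ (2 y + 1)
-- for unique x and y.
code : List ℕ → ℕ
code []       = 0
code (x ∷ xs) = 2 ^ x * suc (2 * code xs)

codeRule : ∀ {s a} → Rule s a → ℕ
codeRule (rule p i ℓ q j) = code (toℕ p ∷ toℕ i ∷ toℕ ℓ ∷ toℕ q ∷ j ∷ [])

codeNet : Net → ℕ
codeNet (net s v rs) = code (s ∷ v ∷ code (map codeRule rs) ∷ [])

record Instance : Set where
  constructor ⟨_,_,_,_⟩
  field
    N      : Net
    normed : Normed N
    P Q    : Process N

encodeInstance : Instance → Vec ℕ 5
encodeInstance ⟨ N , _ , p X^ m , q X^ n ⟩ = codeNet N ∷ toℕ p ∷ m ∷ toℕ q ∷ n ∷ []

-- From a register machine M one builds a normed net whose processes at l X^n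
-- stand for the configurations (l, n) of a counter program that simulates M,
-- its registers being the exponents of pairwise coprime numbers. The node
-- free changes its number of tokens silently, so all free X^m are branching
-- bisimilar; they stand for the configurations answering false. Since
-- at l X^n —τ→ free X^n, the only useful attack on (at l X^n , free X^m) is
-- the visible step of at l. It must be answered by guessing the next
-- configuration (l′, n′), and then either the guess is checked, by counting
-- down two linear functions of n and n′, or the play goes on from
-- (free X^n , at l′ X^n′). Thus at l X^n is branching bisimilar to free if the
-- program answers false from (l, n), and not weakly bisimilar if it answers
-- true. The net does not depend on the number of tokens at the start, so that
-- number can encode the net itself: M errs on the resulting instance. The
-- program first has to compute the input of M, which contains that number.

module Submission where

open import Defs
open import Data.Bool using (Bool; true; false)
open import Data.Fin using (Fin; zero; suc; toℕ; fromℕ<; inject₁)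
open import Data.Fin.Properties using (+↔⊎; *↔×; toℕ-fromℕ<; toℕ-inject₁; toℕ<n)
open import Data.List using (List; []; _∷_; map; concatMap; allFin; filter)
open import Data.List.Membership.Propositional using (_∈_; find; lose)
open import Data.List.Membership.Propositional.Properties
  using (∈-map⁺; ∈-map⁻; ∈-concatMap⁺; ∈-concatMap⁻; ∈-allFin; ∈-filter⁺; ∈-filter⁻)
open import Data.List.Relation.Unary.Any using (here; there)
open import Data.Maybe using (Maybe; just; nothing)
open import Data.Nat
open import Data.Nat.Coprimality as Coprime using (Coprime; coprime-divisor; 1-coprimeTo)
open import Data.Nat.Divisibility
open import Data.Nat.DivMod using (_/_; _%_; m≡m%n+[m/n]*n; m%n<n)
open import Data.Nat.Properties
open import Data.Nat.Tactic.RingSolver using (solve-∀)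
open import Data.Product using (Σ-syntax; ∃-syntax; _×_; _,_; proj₁; proj₂; swap)
open import Data.Product.Function.NonDependent.Propositional using (_×-↔_)
open import Data.Sum using (_⊎_; inj₁; inj₂)
open import Data.Sum.Function.Propositional using (_⊎-↔_)
open import Data.Vec using (Vec; []; _∷_; lookup; replicate; _[_]%=_; _[_]≔_)
open import Function using (flip; _↔_; mk↔ₛ′; Inverse)
open import Function.Properties.Inverse using (↔-sym; ↔-trans)
open import Level using (Level; 0ℓ)
open import Relation.Binary using (Rel; _⇒_)
open import Relation.Binary.Construct.Closure.ReflexiveTransitive as Star using (ε; _◅_; _◅◅_)
open import Relation.Binary.PropositionalEquality
open import Relation.Nullary using (¬_; contradiction; Dec; Reflects; ofʸ; ofⁿ)
open import Relation.Nullary.Decidable using (_×-dec_)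

-- Nets over a finite set of nodes

record Move (S : Set) (visible : ℕ) : Set where
  constructor move
  field
    consume : Fin 2
    label   : Fin (suc visible)
    target  : S
    produce : ℕ

module FiniteNet {S : Set} {k : ℕ} (S↔Fin : S ↔ Fin k) (visible : ℕ)
                 (moves : S → List (Move S visible)) where

  open Inverse S↔Fin using (to; from; strictlyInverseˡ; strictlyInverseʳ)

  toRule : S → Move S visible → Rule k (suc visible)
  toRule s (move i ℓ s′ j) = rule (to s) i ℓ (to s′) j

  rulesFrom : Fin k → List (Rule k (suc visible))
  rulesFrom p = map (toRule (from p)) (moves (from p))

  N : Net
  N = net k visible (concatMap rulesFrom (allFin k))

  open Semantics N public

  ⟪_,_⟫ : S → ℕ → Process N
  ⟪ s , n ⟫ = to s X^ n

  ⟪⟫-surjective : ∀ P → ∃[ s ] ∃[ n ] P ≡ ⟪ s , n ⟫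
  ⟪⟫-surjective (p X^ n) = from p , n , cong (_X^ n) (sym (strictlyInverseˡ p))

  data Fired (s : S) : ℕ → Action N → Process N → Set where
    fired : ∀ {i ℓ s′ j} → move i ℓ s′ j ∈ moves s → ∀ m →
            Fired s (toℕ i + m) ℓ ⟪ s′ , j + m ⟫

  fire⁺ : ∀ {s i ℓ s′ j} → move i ℓ s′ j ∈ moves s → ∀ m →
          ⟪ s , toℕ i + m ⟫ —[ ℓ ]→ ⟪ s′ , j + m ⟫
  fire⁺ {s} mv = fire (∈-concatMap⁺ rulesFrom (lose (∈-allFin (to s)) rule∈))
    where
    rule∈ : toRule s _ ∈ rulesFrom (to s)
    rule∈ rewrite strictlyInverseʳ s = ∈-map⁺ (toRule s) mv

  fire⁻ : ∀ {s n ℓ P′} → ⟪ s , n ⟫ —[ ℓ ]→ P′ → Fired s n ℓ P′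
  fire⁻ {s} st = invert st refl
    where
    -- The source is a variable `p` with an equation, because with `to s` in its place the rule
    -- equation could not be matched with `refl`.
    invert : ∀ {p n ℓ P′} → (p X^ n) —[ ℓ ]→ P′ → p ≡ to s → Fired s n ℓ P′
    invert (fire rule∈ m) eq
      with find (∈-concatMap⁻ rulesFrom {xs = allFin k} rule∈)
    ... | p , _ , rule∈p with ∈-map⁻ (toRule (from p)) rule∈p
    ... | move i ℓ s′ j , mv , refl
      with trans (sym (strictlyInverseʳ (from p))) (trans (cong from eq) (strictlyInverseʳ s))
    ... | refl = fired mv m

-- Finite sets

Finite : Set → Set
Finite A = Σ[ n ∈ ℕ ] (A ↔ Fin n)

finite-Fin : ∀ {n} → Finite (Fin n)
finite-Fin {n} = n , mk↔ₛ′ (λ i → i) (λ i → i) (λ _ → refl) (λ _ → refl)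

finite-⊎ : ∀ {A B} → Finite A → Finite B → Finite (A ⊎ B)
finite-⊎ (m , A↔) (n , B↔) = m + n , ↔-trans (A↔ ⊎-↔ B↔) (↔-sym +↔⊎)

finite-× : ∀ {A B} → Finite A → Finite B → Finite (A × B)
finite-× (m , A↔) (n , B↔) = m * n , ↔-trans (A↔ ×-↔ B↔) (↔-sym *↔×)

finite-Maybe : ∀ {A} → Finite A → Finite (Maybe A)
finite-Maybe {A} (n , A↔) = suc n , mk↔ₛ′ f g f∘g g∘f
  where
  open Inverse A↔
  f : Maybe A → Fin (suc n)
  f nothing  = zero
  f (just a) = suc (to a)
  g : Fin (suc n) → Maybe A
  g zero    = nothing
  g (suc i) = just (from i)
  f∘g : ∀ i → f (g i) ≡ i
  f∘g zero    = refl
  f∘g (suc i) = cong suc (strictlyInverseˡ i)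
  g∘f : ∀ a → g (f a) ≡ a
  g∘f nothing  = refl
  g∘f (just a) = cong just (strictlyInverseʳ a)

-- The game

-- A coefficient c : Fin (suc K) stands for the positive number 1 + c. A line
-- leads from n to (l , n′) if n and n′ are related by one of its branches
-- (c , j , l), namely  value coefficient offset n ≡ value c j n′.
record Line (Λ : Set) (K : ℕ) : Set where
  constructor line
  field
    coefficient offset : Fin (suc K)
    branches           : List (Fin (suc K) × Fin (suc K) × Λ)

value : ∀ {K} → Fin (suc K) → Fin (suc K) → ℕ → ℕ
value c j n = suc (toℕ c) * n + toℕ j

-- A token is worth `1 + c` ticks: spending it makes one tick and leaves the other `c` as the new
-- offset. This is why `c` also serves as an offset.
value-zero : ∀ {K} (c : Fin (suc K)) n → value c zero (suc n) ≡ suc (value c c n)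
value-zero c n = begin
  suc (toℕ c) * suc n + 0          ≡⟨ +-identityʳ _ ⟩
  suc (toℕ c) * suc n              ≡⟨ *-suc (suc (toℕ c)) n ⟩
  suc (toℕ c) + suc (toℕ c) * n    ≡⟨ cong suc (+-comm (toℕ c) _) ⟩
  suc (suc (toℕ c) * n + toℕ c)    ∎
  where open ≡-Reasoning

value-suc : ∀ {K} (c : Fin (suc K)) (j : Fin K) n → value c (suc j) n ≡ suc (value c (inject₁ j) n)
value-suc c j n = trans (+-suc _ _) (cong (λ x → suc (suc (toℕ c) * n + x)) (sym (toℕ-inject₁ j)))

-- count c j X^n makes exactly value c j n ticks. mid c j t is the position
-- between a step and the choice of checking it or going on to anchor t.
data Node (Λ : Set) (K : ℕ) : Set where
  anchor : Maybe Λ → Node Λ K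
  dead   : Node Λ K
  count  : Fin (suc K) → Fin (suc K) → Node Λ K
  mid    : Fin (suc K) → Fin (suc K) → Maybe Λ → Node Λ K

pattern free = anchor nothing
pattern at l = anchor (just l)

finite-Node : ∀ {Λ} {K} → Finite Λ → Finite (Node Λ K)
finite-Node {Λ} {K} Λ-finite = let n , A↔ = sum-finite in n , ↔-trans (mk↔ₛ′ f g f∘g g∘f) A↔
  where
  Sum : Set
  Sum = Maybe Λ ⊎ (Fin 1 ⊎ ((Fin (suc K) × Fin (suc K)) ⊎ (Fin (suc K) × Fin (suc K) × Maybe Λ)))
  sum-finite : Finite Sum
  sum-finite =
    finite-⊎ (finite-Maybe Λ-finite) (finite-⊎ finite-Fin
      (finite-⊎ (finite-× finite-Fin finite-Fin)
                (finite-× finite-Fin (finite-× finite-Fin (finite-Maybe Λ-finite)))))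
  f : Node Λ K → Sum
  f (anchor t)  = inj₁ t
  f dead        = inj₂ (inj₁ zero)
  f (count c j) = inj₂ (inj₂ (inj₁ (c , j)))
  f (mid c j t) = inj₂ (inj₂ (inj₂ (c , j , t)))
  g : Sum → Node Λ K
  g (inj₁ t)                         = anchor t
  g (inj₂ (inj₁ zero))               = dead
  g (inj₂ (inj₂ (inj₁ (c , j))))     = count c j
  g (inj₂ (inj₂ (inj₂ (c , j , t)))) = mid c j t
  f∘g : ∀ x → f (g x) ≡ x
  f∘g (inj₁ t)               = refl
  f∘g (inj₂ (inj₁ zero))     = refl
  f∘g (inj₂ (inj₂ (inj₁ _))) = refl
  f∘g (inj₂ (inj₂ (inj₂ _))) = refl
  g∘f : ∀ x → g (f x) ≡ x
  g∘f (anchor t)  = refl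
  g∘f dead        = refl
  g∘f (count c j) = refl
  g∘f (mid c j t) = refl

-- `giveUp` is there for normedness: every node but `dead` can move to `dead` by it. Each line has
-- its own action `step x`, so `free` must answer with a branch of the line attacked.
pattern silent   = zero
pattern giveUp   = suc zero
pattern check    = suc (suc zero)
pattern continue = suc (suc (suc zero))
pattern tick     = suc (suc (suc (suc zero)))
pattern step x   = suc (suc (suc (suc (suc x))))

module Game {Λ : Set} {K L k : ℕ} (Λ↔Fin : Λ ↔ Fin L) (Node↔Fin : Node Λ K ↔ Fin k)
            (lines : Λ → Line Λ K) where

  open Inverse Λ↔Fin using (to; from; strictlyInverseʳ)
  open Line

  response : Fin L → Fin (suc K) × Fin (suc K) × Λ → Move (Node Λ K) (4 + L)
  response x (c , j , l′) = move zero (step x) (mid c j (just l′)) 0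

  responsesAt : Fin L → List (Move (Node Λ K) (4 + L))
  responsesAt x = map (response x) (branches (lines (from x)))

  responses : List (Move (Node Λ K) (4 + L))
  responses = concatMap responsesAt (allFin L)

  moves : Node Λ K → List (Move (Node Λ K) (4 + L))
  moves free =
    move zero silent free 1 ∷
    move (suc zero) silent free 0 ∷
    move zero giveUp dead 0 ∷
    responses
  moves (at l) =
    move zero silent free 0 ∷
    move zero giveUp dead 0 ∷
    move zero (step (to l)) (mid (coefficient (lines l)) (offset (lines l)) nothing) 0 ∷ []
  moves dead = move (suc zero) silent dead 0 ∷ []
  moves (count c zero) =
    move zero giveUp dead 0 ∷
    move (suc zero) tick (count c c) 0 ∷ []
  moves (count c (suc j)) =
    move zero giveUp dead 0 ∷
    move zero tick (count c (inject₁ j)) 0 ∷ []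
  moves (mid c j t) =
    move zero giveUp dead 0 ∷
    move zero check (count c j) 0 ∷
    move zero continue (anchor t) 0 ∷ []

  open FiniteNet Node↔Fin (4 + L) moves public renaming (_⇒_ to _⟹_)

  ∈-responses⁺ : ∀ {l c j l′} → (c , j , l′) ∈ branches (lines l) →
                 response (to l) (c , j , l′) ∈ responses
  ∈-responses⁺ {l} {c} {j} {l′} b =
    ∈-concatMap⁺ responsesAt (lose (∈-allFin (to l)) response∈)
    where
    response∈ : response (to l) (c , j , l′) ∈ responsesAt (to l)
    response∈ rewrite strictlyInverseʳ l = ∈-map⁺ (response (to l)) b

  ∈-responses⁻ : ∀ {mv} → mv ∈ responses →
    ∃[ x ] ∃[ c ] ∃[ j ] ∃[ l ] ((c , j , l) ∈ branches (lines (from x)) × mv ≡ response x (c , j , l))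
  ∈-responses⁻ mv∈ with find (∈-concatMap⁻ responsesAt {xs = allFin L} mv∈)
  ... | x , _ , mv∈x with ∈-map⁻ (response x) mv∈x
  ... | (c , j , l) , b , eq = x , c , j , l , b , eq

  -- Silent runs, ticks and normedness

  dead-drains : ∀ n → ⟪ dead , n ⟫ ⟹ ⟪ dead , 0 ⟫
  dead-drains zero    = ε
  dead-drains (suc n) = fire⁺ (here refl) n ◅ dead-drains n

  dead-stuck : Stuck ⟪ dead , 0 ⟫
  dead-stuck ℓ P′ s = impossible (fire⁻ s) refl
    where
    impossible : ∀ {n} → Fired dead n ℓ P′ → ¬ (n ≡ 0)
    impossible (fired (here refl) m) ()

  free⇒free : ∀ m n → ⟪ free , m ⟫ ⟹ ⟪ free , n ⟫
  free⇒free m n = down m ◅◅ up n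
    where
    down : ∀ m → ⟪ free , m ⟫ ⟹ ⟪ free , 0 ⟫
    down zero    = ε
    down (suc m) = fire⁺ (there (here refl)) m ◅ down m
    up : ∀ n → ⟪ free , 0 ⟫ ⟹ ⟪ free , n ⟫
    up zero    = ε
    up (suc n) = up n ◅◅ (fire⁺ (here refl) n ◅ ε)

  count-giveUp : ∀ c j n → ⟪ count c j , n ⟫ —[ giveUp ]→ ⟪ dead , n ⟫
  count-giveUp c zero    n = fire⁺ (here refl) n
  count-giveUp c (suc j) n = fire⁺ (here refl) n

  count-tick : ∀ c j n {v} → value c j n ≡ suc v →
    ∃[ j′ ] ∃[ n′ ] (⟪ count c j , n ⟫ —[ tick ]→ ⟪ count c j′ , n′ ⟫ × value c j′ n′ ≡ v)
  count-tick c zero    zero    eq = contradiction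
    (trans (sym eq) (trans (+-identityʳ (toℕ c * 0)) (*-zeroʳ (toℕ c)))) λ ()
  count-tick c zero    (suc n) eq = c , n , fire⁺ (there (here refl)) n ,
    suc-injective (trans (sym (value-zero c n)) eq)
  count-tick c (suc j) n       eq = inject₁ j , n , fire⁺ (there (here refl)) n ,
    suc-injective (trans (sym (value-suc c j n)) eq)

  drain : ∀ n → ⟪ dead , n ⟫ —→* ⟪ dead , 0 ⟫
  drain n = Star.map (silent ,_) (dead-drains n)

  reaches-dead : ∀ s n → ⟪ s , n ⟫ —→* ⟪ dead , 0 ⟫
  reaches-dead free        n = (giveUp , fire⁺ (there (there (here refl))) n) ◅ drain n
  reaches-dead (at l)      n = (giveUp , fire⁺ (there (here refl)) n) ◅ drain n
  reaches-dead dead        n = drain n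
  reaches-dead (count c j) n = (giveUp , count-giveUp c j n) ◅ drain n
  reaches-dead (mid c j t) n = (giveUp , fire⁺ (here refl) n) ◅ drain n

  N-normed : Normed N
  N-normed P with ⟪⟫-surjective P
  ... | s , n , refl = _ , reaches-dead s n , dead-stuck

  -- Branching bisimilarity of won configurations

  module Bisimilar
    (W : Λ → ℕ → Set)
    (W-advances : ∀ {l n} → W l n →
      ∃[ c ] ∃[ j ] ∃[ l′ ] ∃[ n′ ] ((c , j , l′) ∈ branches (lines l) ×
        value (coefficient (lines l)) (offset (lines l)) n ≡ value c j n′ × W l′ n′))
    where

    -- The positions won for the bisimulation. `W` only has to be preserved by some branch, so
    -- infinite plays are included. In `mids`, the equation answers `check` and `W` answers
    -- `continue`, which exchanges the roles of the two sides: `won` is followed by `won⁻`.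
    data _∼_ : Rel (Process N) 0ℓ where
      same    : ∀ {P} → P ∼ P
      deads   : ∀ {m n} → ⟪ dead , m ⟫ ∼ ⟪ dead , n ⟫
      frees   : ∀ {m n} → ⟪ free , m ⟫ ∼ ⟪ free , n ⟫
      won     : ∀ {l n m} → W l n → ⟪ at l , n ⟫ ∼ ⟪ free , m ⟫
      won⁻    : ∀ {l n m} → W l n → ⟪ free , m ⟫ ∼ ⟪ at l , n ⟫
      mids    : ∀ {c j n c′ j′ l′ n′} → value c j n ≡ value c′ j′ n′ → W l′ n′ →
                ⟪ mid c j nothing , n ⟫ ∼ ⟪ mid c′ j′ (just l′) , n′ ⟫
      mids⁻   : ∀ {c j n c′ j′ l′ n′} → value c j n ≡ value c′ j′ n′ → W l′ n′ →
                ⟪ mid c′ j′ (just l′) , n′ ⟫ ∼ ⟪ mid c j nothing , n ⟫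
      counts  : ∀ {c j n c′ j′ n′} → value c j n ≡ value c′ j′ n′ →
                ⟪ count c j , n ⟫ ∼ ⟪ count c′ j′ , n′ ⟫

    ∼-sym : ∀ {P Q} → P ∼ Q → Q ∼ P
    ∼-sym same        = same
    ∼-sym deads       = deads
    ∼-sym frees       = frees
    ∼-sym (won w)     = won⁻ w
    ∼-sym (won⁻ w)    = won w
    ∼-sym (mids e w)  = mids⁻ e w
    ∼-sym (mids⁻ e w) = mids e w
    ∼-sym (counts e)  = counts (sym e)

    ∼-simulation : BranchingSimulation _∼_
    ∼-simulation same st = inj₁ (_ , _ , ε , st , same , same)
    ∼-simulation deads st with fire⁻ st
    ... | fired (here refl) _ = inj₂ (refl , deads)
    ∼-simulation (frees {n = n}) st with fire⁻ st
    ... | fired (here refl) _ = inj₂ (refl , frees)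
    ... | fired (there (here refl)) _ = inj₂ (refl , frees)
    ... | fired (there (there (here refl))) _ =
      inj₁ (_ , _ , ε , fire⁺ (there (there (here refl))) n , frees , deads)
    ... | fired (there (there (there r))) m with ∈-responses⁻ r
    ... | _ , _ , _ , _ , b , refl =
      inj₁ (_ , _ , free⇒free n m , st , frees , same)
    ∼-simulation (won {m = m} w) st with fire⁻ st
    ... | fired (here refl) _ = inj₂ (refl , frees)
    ... | fired (there (here refl)) _ =
      inj₁ (_ , _ , ε , fire⁺ (there (there (here refl))) m , won w , deads)
    ... | fired (there (there (here refl))) _ =
      -- The guess: `free` first moves silently to the `n′` of the next configuration. It stays
      -- related to `at l`, as `won` allows any number of tokens.
      let _ , _ , _ , n′ , b , eq , w′ = W-advances w
          answer = fire⁺ (there (there (there (∈-responses⁺ b)))) n′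
      in inj₁ (_ , _ , free⇒free m n′ , answer , won w , mids eq w′)
    ∼-simulation (won⁻ {l = l} {n = n} w) st with fire⁻ st
    ... | fired (here refl) _ = inj₂ (refl , won⁻ w)
    ... | fired (there (here refl)) _ = inj₂ (refl , won⁻ w)
    ... | fired (there (there (here refl))) _ =
      inj₁ (_ , _ , ε , fire⁺ (there (here refl)) n , won⁻ w , deads)
    ... | fired (there (there (there r))) m with ∈-responses⁻ r
    ... | _ , _ , _ , _ , b , refl =
      -- `at l` becomes `free` silently, takes on the same number of tokens and copies the move.
      inj₁ (_ , _ , fire⁺ {at l} (here refl) n ◅ free⇒free n m , st , frees , same)
    ∼-simulation (mids {n′ = n′} e w) st with fire⁻ st
    ... | fired (here refl) _ =
      inj₁ (_ , _ , ε , fire⁺ (here refl) n′ , mids e w , deads)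
    ... | fired (there (here refl)) _ =
      inj₁ (_ , _ , ε , fire⁺ (there (here refl)) n′ , mids e w , counts e)
    ... | fired (there (there (here refl))) _ =
      inj₁ (_ , _ , ε , fire⁺ (there (there (here refl))) n′ , mids e w , won⁻ w)
    ∼-simulation (mids⁻ {n = n} e w) st with fire⁻ st
    ... | fired (here refl) _ =
      inj₁ (_ , _ , ε , fire⁺ (here refl) n , mids⁻ e w , deads)
    ... | fired (there (here refl)) _ =
      inj₁ (_ , _ , ε , fire⁺ (there (here refl)) n , mids⁻ e w , counts (sym e))
    ... | fired (there (there (here refl))) _ =
      inj₁ (_ , _ , ε , fire⁺ (there (there (here refl))) n , mids⁻ e w , won w)
    ∼-simulation (counts {c} {zero} {n} {c′} {j′} {n′} e) st with fire⁻ st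
    ... | fired (here refl) _ =
      inj₁ (_ , _ , ε , count-giveUp c′ j′ n′ , counts e , deads)
    ... | fired (there (here refl)) m =
      let _ , _ , st′ , e′ = count-tick c′ j′ n′ (trans (sym e) (value-zero c m))
      in inj₁ (_ , _ , ε , st′ , counts e , counts (sym e′))
    ∼-simulation (counts {c} {suc j} {n} {c′} {j′} {n′} e) st with fire⁻ st
    ... | fired (here refl) _ =
      inj₁ (_ , _ , ε , count-giveUp c′ j′ n′ , counts e , deads)
    ... | fired (there (here refl)) m =
      let _ , _ , st′ , e′ = count-tick c′ j′ n′ (trans (sym e) (value-suc c j m))
      in inj₁ (_ , _ , ε , st′ , counts e , counts (sym e′))

    bisimilar : ∀ {l n m} → W l n → BranchingBisimilar N ⟪ at l , n ⟫ ⟪ free , m ⟫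
    bisimilar w = _∼_ , (∼-simulation , flipped) , won w
      where
      flipped : BranchingSimulation (flip _∼_)
      flipped PQ st with ∼-simulation (∼-sym PQ) st
      ... | inj₁ (_ , _ , τs , st′ , PQ″ , P′Q′) = inj₁ (_ , _ , τs , st′ , ∼-sym PQ″ , ∼-sym P′Q′)
      ... | inj₂ (eq , P′Q) = inj₂ (eq , ∼-sym P′Q)

  -- Weak bisimulations and lost configurations

  count-tick⁻ : ∀ {c j n P′} → ⟪ count c j , n ⟫ —[ tick ]→ P′ →
    ∃[ j′ ] ∃[ n′ ] (P′ ≡ ⟪ count c j′ , n′ ⟫ × value c j n ≡ suc (value c j′ n′))
  count-tick⁻ {c} {zero} st with fire⁻ st
  ... | fired (there (here refl)) m = _ , _ , refl , value-zero c m
  count-tick⁻ {c} {suc j} st with fire⁻ st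
  ... | fired (there (here refl)) m = _ , _ , refl , value-suc c j m

  -- Between such nodes a weak answer with a visible action is a single step.
  Quiet : Node Λ K → Set
  Quiet s = ∀ {n P} → ¬ (⟪ s , n ⟫ —[ silent ]→ P)

  quiet-⇒ : ∀ {s n P} → Quiet s → ⟪ s , n ⟫ ⟹ P → P ≡ ⟪ s , n ⟫
  quiet-⇒ q ε        = refl
  quiet-⇒ q (st ◅ _) = contradiction st q

  count-quiet : ∀ {c j} → Quiet (count c j)
  count-quiet {j = zero} st with fire⁻ st
  ... | fired (there (here ())) _
  ... | fired (there (there ())) _
  count-quiet {j = suc j} st with fire⁻ st
  ... | fired (there (here ())) _
  ... | fired (there (there ())) _

  mid-quiet : ∀ {c j t} → Quiet (mid c j t)
  mid-quiet st with fire⁻ st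
  ... | fired (there (there (here ()))) _
  ... | fired (there (there (there ()))) _

  free-⇒ : ∀ {m P} → ⟪ free , m ⟫ ⟹ P → ∃[ n ] P ≡ ⟪ free , n ⟫
  free-⇒ ε = _ , refl
  free-⇒ (st ◅ sts) with fire⁻ st
  ... | fired (here refl) _ = free-⇒ sts
  ... | fired (there (here refl)) _ = free-⇒ sts
  ... | fired (there (there (there r))) _ with ∈-responses⁻ r
  ... | _ , _ , _ , _ , _ , ()

  -- Inductive, as the attacker must win after finitely many rounds. Only an `n′` satisfying the
  -- equation of its branch counts; any other guess is refuted by the check.
  data Lost : Λ → ℕ → Set where
    lost : ∀ {l n} →
      (∀ {c j l′ n′} → (c , j , l′) ∈ branches (lines l) →
        value (coefficient (lines l)) (offset (lines l)) n ≡ value c j n′ → Lost l′ n′) →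
      Lost l n

  module _ {B : Rel (Process N) 0ℓ} (bisim : WeakBisimulation B) where

    private
      left  = proj₁ bisim
      right = proj₂ bisim

    -- Ticks are matched one by one until the left side has none left. The recursion is on the
    -- value, since the offset returns to `c` whenever a token is spent.
    counts-agree : ∀ v {c j n c′ j′ n′} → value c j n ≡ v →
      B ⟪ count c j , n ⟫ ⟪ count c′ j′ , n′ ⟫ → value c′ j′ n′ ≡ v
    counts-agree zero {c} {j} {n} {c′} {j′} {n′} eq PQ with value c′ j′ n′ in eq′
    ... | zero = refl
    ... | suc v with count-tick c′ j′ n′ eq′
    ... | _ , _ , st , _ with right PQ st
    ... | _ , (_ , _ , τs , st′ , _) , _ with quiet-⇒ count-quiet τs
    ... | refl with count-tick⁻ st′
    ... | _ , _ , _ , eq″ = contradiction (trans (sym eq) eq″) λ ()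
    counts-agree (suc v) {c} {j} {n} eq PQ with count-tick c j n eq
    ... | _ , _ , st , eq₁ with left PQ st
    ... | _ , (_ , _ , τs , st′ , τs′) , PQ′ with quiet-⇒ count-quiet τs
    ... | refl with count-tick⁻ st′
    ... | _ , _ , refl , eq₂ with quiet-⇒ count-quiet τs′
    ... | refl = trans eq₂ (cong suc (counts-agree v eq₁ PQ′))

    mids-check : ∀ {c j t n c′ j′ t′ n′} →
      B ⟪ mid c j t , n ⟫ ⟪ mid c′ j′ t′ , n′ ⟫ → value c j n ≡ value c′ j′ n′
    mids-check {n = n} PQ with left PQ (fire⁺ (there (here refl)) n)
    ... | _ , (_ , _ , τs , st′ , τs′) , PQ′ with quiet-⇒ mid-quiet τs
    ... | refl with fire⁻ st′
    ... | fired (there (there (there ()))) _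
    ... | fired (there (here refl)) _ with quiet-⇒ count-quiet τs′
    ... | refl = sym (counts-agree _ refl PQ′)

    -- Only the move of the right-hand process is a threat: after the one of
    -- the left-hand process, a weak answer could go on silently to free.
    mids-continue : ∀ {c j n c′ j′ l n′} →
      B ⟪ mid c j nothing , n ⟫ ⟪ mid c′ j′ (just l) , n′ ⟫ →
      ∃[ m ] B ⟪ free , m ⟫ ⟪ at l , n′ ⟫
    mids-continue {n′ = n′} PQ with right PQ (fire⁺ (there (there (here refl))) n′)
    ... | _ , (_ , _ , τs , st′ , τs′) , PQ′ with quiet-⇒ mid-quiet τs
    ... | refl with fire⁻ st′
    ... | fired (there (there (there ()))) _
    ... | fired (there (there (here refl))) _ with free-⇒ τs′
    ... | _ , refl = _ , PQ′

  -- One round per layer of `Lost`: the answer to the step of `at l` fixes a branch and an `n′`,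
  -- `check` forces the equation, and `continue` gives the next pair with its sides exchanged. Hence
  -- `B` varies and the recursive call takes `swap bisim`.
  distinguished : ∀ {l n} → Lost l n → ∀ {B} → WeakBisimulation B →
                  ∀ m → ¬ B ⟪ at l , n ⟫ ⟪ free , m ⟫
  distinguished {l} {n} (lost next) bisim m PQ
    with proj₁ bisim PQ (fire⁺ (there (there (here refl))) n)
  ... | _ , (_ , _ , τs , st′ , τs′) , PQ′ with free-⇒ τs
  ... | _ , refl with fire⁻ st′
  ... | fired (there (there (there r))) _ with ∈-responses⁻ r
  ... | _ , _ , _ , _ , b , refl with quiet-⇒ mid-quiet τs′
  ... | refl with mids-continue bisim PQ′
  ... | m′ , QP = distinguished
    -- The label of the step names the line as `from (to l)`.
    (next (subst (λ l → _ ∈ branches (lines l)) (strictlyInverseʳ l) b) (mids-check bisim PQ′))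
    (swap bisim) m′ QP

-- Counter programs

data Command (Λ : Set) (K : ℕ) : Set where
  halt : Bool → Command Λ K
  mul  : Fin (suc K) → Λ → Command Λ K
  div  : Fin (suc K) → Λ → Λ → Command Λ K

module CounterProgram {Λ : Set} {K : ℕ} (commands : Λ → Command Λ K) where

  data _,_↓_ : Λ → ℕ → Bool → Set where
    halt    : ∀ {l n b} → commands l ≡ halt b → l , n ↓ b
    mul     : ∀ {l n b c l₁} → commands l ≡ mul c l₁ →
              l₁ , suc (toℕ c) * n ↓ b → l , n ↓ b
    div-yes : ∀ {l n b c l₁ l₂ q} → commands l ≡ div c l₁ l₂ →
              n ≡ suc (toℕ c) * q → l₁ , q ↓ b → l , n ↓ b
    div-no  : ∀ {l n b c l₁ l₂} → commands l ≡ div c l₁ l₂ →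
              ¬ suc (toℕ c) ∣ n → l₂ , n ↓ b → l , n ↓ b

  -- restore c j l multiplies a quotient by 1 + c and adds the remainder j.
  Λ⁺ : Set
  Λ⁺ = Λ ⊎ (Fin (suc K) × Fin (suc K) × Λ)

  pattern base l        = inj₁ l
  pattern restore c j l = inj₂ (c , j , l)

  Remainder : Fin (suc K) → Fin (suc K) → Set
  Remainder c j = 0 < toℕ j × toℕ j ≤ toℕ c

  remainder? : ∀ c j → Dec (Remainder c j)
  remainder? c j = (0 <? toℕ j) ×-dec (toℕ j ≤? toℕ c)

  failure : Fin (suc K) → Λ → Fin (suc K) → Fin (suc K) × Fin (suc K) × Λ⁺
  failure c l j = c , j , restore c j l

  -- Non-divisibility is witnessed by a nonzero remainder `j`. The equation of such a branch turns
  -- the counter into the quotient, so the next line has to restore it.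
  failures : Fin (suc K) → Λ → List (Fin (suc K) × Fin (suc K) × Λ⁺)
  failures c l = map (failure c l) (filter (remainder? c) (allFin (suc K)))

  -- Rejecting is having no branch: the step of the line cannot be answered.
  -- Accepting is looping: an infinite play is won by the bisimulation.
  commandLine : Λ → Command Λ K → Line Λ⁺ K
  commandLine l (halt true)    = line zero zero []
  commandLine l (halt false)   = line zero zero ((zero , zero , base l) ∷ [])
  commandLine l (mul c l₁)     = line c zero ((zero , zero , base l₁) ∷ [])
  commandLine l (div c l₁ l₂)  = line zero zero ((c , zero , base l₁) ∷ failures c l₂)

  lines : Λ⁺ → Line Λ⁺ K
  lines (base l)        = commandLine l (commands l)
  lines (restore c j l) = line c j ((zero , zero , base l) ∷ [])

  open Line

  value₁ : ∀ n → value {K} zero zero n ≡ n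
  value₁ n = trans (+-identityʳ _) (*-identityˡ n)

  Accepts : Λ⁺ → ℕ → Set
  Accepts (base l)        n = l , n ↓ false
  Accepts (restore c j l) n = l , value c j n ↓ false

  Advances : (Λ⁺ → ℕ → Set) → Line Λ⁺ K → ℕ → Set
  Advances W ln n = ∃[ c ] ∃[ j ] ∃[ l′ ] ∃[ n′ ] ((c , j , l′) ∈ branches ln ×
    value (coefficient ln) (offset ln) n ≡ value c j n′ × W l′ n′)

  quotient-remainder : ∀ c n → ¬ suc (toℕ c) ∣ n →
    ∃[ j ] ∃[ q ] (Remainder c j × n ≡ value c j q)
  quotient-remainder c n ∤ = j , n / d , (0<j , j≤c) , eq
    where
    d : ℕ
    d = suc (toℕ c)
    r≤c : n % d ≤ toℕ c
    r≤c = ≤-pred (m%n<n n d)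
    r<1+K : n % d < suc K
    r<1+K = ≤-<-trans r≤c (toℕ<n c)
    j : Fin (suc K)
    j = fromℕ< r<1+K
    j≡r : toℕ j ≡ n % d
    j≡r = toℕ-fromℕ< r<1+K
    0<j : 0 < toℕ j
    0<j = n≢0⇒n>0 λ j≡0 → ∤ (m%n≡0⇒n∣m n d (trans (sym j≡r) j≡0))
    j≤c : toℕ j ≤ toℕ c
    j≤c = subst (_≤ toℕ c) (sym j≡r) r≤c
    eq : n ≡ value c j (n / d)
    eq = begin
      n                        ≡⟨ m≡m%n+[m/n]*n n d ⟩
      n % d + n / d * d        ≡⟨ +-comm (n % d) _ ⟩
      n / d * d + n % d        ≡⟨ cong₂ _+_ (*-comm (n / d) d) (sym j≡r) ⟩
      d * (n / d) + toℕ j      ∎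
      where open ≡-Reasoning

  accepts-advances : ∀ {l n} → Accepts l n → Advances Accepts (lines l) n
  accepts-advances {restore c j l} {n} run =
    zero , zero , base l , value c j n , here refl , sym (value₁ _) , run
  accepts-advances {base l} {n} run@(halt eq) =
    -- The accepting line leads back to the same configuration, so the same run serves again.
    subst (λ cmd → Advances Accepts (commandLine l cmd) n) (sym eq)
      (zero , zero , base l , n , here refl , refl , run)
  accepts-advances {base l} {n} (mul {l₁ = l₁} eq run) =
    subst (λ cmd → Advances Accepts (commandLine l cmd) n) (sym eq)
      (zero , zero , base l₁ , _ , here refl , trans (+-identityʳ _) (sym (value₁ _)) , run)
  accepts-advances {base l} {n} (div-yes {l₁ = l₁} eq n≡ run) =
    subst (λ cmd → Advances Accepts (commandLine l cmd) n) (sym eq)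
      (_ , zero , base l₁ , _ , here refl ,
       trans (value₁ n) (trans n≡ (sym (+-identityʳ _))) , run)
  accepts-advances {base l} {n} (div-no {c = c} {l₂ = l₂} eq ∤ run) =
    let j , q , rem , n≡ = quotient-remainder c n ∤
    in subst (λ cmd → Advances Accepts (commandLine l cmd) n) (sym eq)
      (c , j , restore c j l₂ , q ,
       there (∈-map⁺ (failure c l₂) (∈-filter⁺ (remainder? c) (∈-allFin j) rem)) ,
       trans (value₁ n) n≡ , subst (λ m → l₂ , m ↓ false) n≡ run)

  -- The divisor would divide `toℕ j`, which is positive and smaller.
  remainder-∤ : ∀ {c j} → Remainder c j → ∀ q → ¬ suc (toℕ c) ∣ value c j q
  remainder-∤ (0<j , j≤c) q d∣ =
    <⇒≱ (s≤s j≤c) (∣⇒≤ {{>-nonZero 0<j}} (∣m+n∣m⇒∣n d∣ (m∣m*n q)))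

  module _ {L k : ℕ} (Λ↔Fin : Λ⁺ ↔ Fin L) (Node↔Fin : Node Λ⁺ K ↔ Fin k) where

    open Game Λ↔Fin Node↔Fin lines

    LostAt : Line Λ⁺ K → ℕ → Set
    LostAt ln n = ∀ {c j l′ n′} → (c , j , l′) ∈ branches ln →
      value (coefficient ln) (offset ln) n ≡ value c j n′ → Lost l′ n′

    -- By induction on the run: a branch whose equation can hold leads where the program goes, and
    -- the wrong outcome of a division contradicts arithmetic.
    rejects-lost : ∀ {l n} → l , n ↓ true → Lost (base l) n
    rejects-lost {l} {n} (halt eq) =
      lost (subst (λ cmd → LostAt (commandLine l cmd) n) (sym eq) λ ())
    rejects-lost {l} {n} (mul {c = c} {l₁} eq run) =
      lost (subst (λ cmd → LostAt (commandLine l cmd) n) (sym eq) next)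
      where
      next : LostAt (commandLine l (mul c l₁)) n
      next (here refl) v≡ = subst (Lost (base l₁))
        (trans (sym (+-identityʳ _)) (trans v≡ (value₁ _))) (rejects-lost run)
    rejects-lost {l} {n} (div-yes {c = c} {l₁} {l₂} {q} eq n≡ run) =
      lost (subst (λ cmd → LostAt (commandLine l cmd) n) (sym eq) next)
      where
      next : LostAt (commandLine l (div c l₁ l₂)) n
      next (here refl) v≡ = subst (Lost (base l₁))
        (*-cancelˡ-≡ _ _ (suc (toℕ c)) (trans (sym n≡) (trans (sym (value₁ n)) (trans v≡ (+-identityʳ _)))))
        (rejects-lost run)
      next {n′ = n′} (there b) v≡ with ∈-map⁻ (failure c l₂) b
      ... | j , j∈ , refl = contradiction
        (divides q (trans (sym v≡) (trans (value₁ n) (trans n≡ (*-comm (suc (toℕ c)) q)))))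
        (remainder-∤ {c} {j} (proj₂ (∈-filter⁻ (remainder? c) {xs = allFin (suc K)} j∈)) n′)
    rejects-lost {l} {n} (div-no {c = c} {l₁} {l₂} eq ∤ run) =
      lost (subst (λ cmd → LostAt (commandLine l cmd) n) (sym eq) next)
      where
      next : LostAt (commandLine l (div c l₁ l₂)) n
      next {n′ = n′} (here refl) v≡ = contradiction
        (divides n′ (trans (sym (value₁ n)) (trans v≡ (trans (+-identityʳ _) (*-comm (suc (toℕ c)) n′)))))
        ∤
      next {n′ = n′} (there b) v≡ with ∈-map⁻ (failure c l₂) b
      -- A failed division takes a second round, in which `restore` rebuilds `n`.
      ... | j , _ , refl = lost λ { (here refl) v≡′ → subst (Lost (base l₂))
        (trans (sym (value₁ n)) (trans v≡ (trans v≡′ (value₁ _)))) (rejects-lost run) }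

-- Gödel numbering by Sylvester's sequence

*-leftComm : ∀ a b c → a * (b * c) ≡ b * (a * c)
*-leftComm = solve-∀

coprime-* : ∀ {m n o} → Coprime m n → Coprime m o → Coprime m (n * o)
coprime-* m⊥n m⊥o (d∣m , d∣no) = m⊥o (d∣m , coprime-divisor
  (λ { (e∣d , e∣n) → m⊥n (∣-trans e∣d d∣m , e∣n) }) d∣no)

coprime-^ : ∀ {m n} → Coprime m n → ∀ k → Coprime m (n ^ k)
coprime-^ m⊥n zero    = Coprime.sym (1-coprimeTo _)
coprime-^ m⊥n (suc k) = coprime-* m⊥n (coprime-^ m⊥n k)

-- Opaque, so that the large constants of the program are never evaluated.
opaque

  -- Sylvester's sequence 2, 3, 7, 43, …
  mutual
    sylvester : ℕ → ℕ
    sylvester r = suc (sylvesterProduct r)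

    sylvesterProduct : ℕ → ℕ
    sylvesterProduct zero    = 1
    sylvesterProduct (suc r) = sylvesterProduct r * sylvester r

  sylvester-suc : ∀ r → suc (sylvesterProduct r) ≡ sylvester r
  sylvester-suc r = refl

  sylvester-nonZero : ∀ r → NonZero (sylvester r)
  sylvester-nonZero r = _

  sylvesterProduct-∣ : ∀ {r s} → r ≤′ s → sylvesterProduct r ∣ sylvesterProduct s
  sylvesterProduct-∣ ≤′-refl       = ∣-refl
  sylvesterProduct-∣ (≤′-step r≤s) = ∣-trans (sylvesterProduct-∣ r≤s) (m∣m*n _)

  sylvesterProduct-nonZero : ∀ r → NonZero (sylvesterProduct r)
  sylvesterProduct-nonZero zero    = _
  sylvesterProduct-nonZero (suc r) = m*n≢0 _ _ {{sylvesterProduct-nonZero r}}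

  sylvester-∣ : ∀ {r s} → r < s → sylvester r ∣ sylvesterProduct s
  sylvester-∣ {r} r<s = ∣-trans (n∣m*n (sylvesterProduct r)) (sylvesterProduct-∣ (≤⇒≤′ r<s))

  -- `sylvester s` exceeds by 1 a product with the factor `sylvester r`, so a common divisor divides
  -- 1.
  sylvester-coprime-< : ∀ {r s} → r < s → Coprime (sylvester r) (sylvester s)
  sylvester-coprime-< {r} {s} r<s {d} (d∣r , d∣s) = ∣1⇒≡1
    (∣m+n∣m⇒∣n (subst (d ∣_) (+-comm 1 (sylvesterProduct s)) d∣s) (∣-trans d∣r (sylvester-∣ r<s)))

  gödel : ∀ {n} → ℕ → Vec ℕ n → ℕ
  gödel k []       = 1
  gödel k (x ∷ xs) = sylvester k ^ x * gödel (suc k) xs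

  gödel-add : ∀ k {n} (v : Vec ℕ n) r m →
    gödel k (v [ r ]%= (m +_)) ≡ sylvester (k + toℕ r) ^ m * gödel k v
  gödel-add k (x ∷ v) zero m rewrite +-identityʳ k =
    trans (cong (_* gödel (suc k) v) (^-distribˡ-+-* (sylvester k) m x)) (*-assoc (sylvester k ^ m) _ _)
  gödel-add k (x ∷ v) (suc r) m rewrite +-suc k (toℕ r) =
    trans (cong (sylvester k ^ x *_) (gödel-add (suc k) v r m))
          (*-leftComm (sylvester k ^ x) (sylvester (suc k + toℕ r) ^ m) (gödel (suc k) v))

  gödel-inc : ∀ k {n} (v : Vec ℕ n) r →
    gödel k (v [ r ]%= suc) ≡ sylvester (k + toℕ r) * gödel k v
  gödel-inc k v r = trans (gödel-add k v r 1) (cong (_* gödel k v) (*-identityʳ (sylvester (k + toℕ r))))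

  gödel-dec : ∀ k {n} (v : Vec ℕ n) r {c} → lookup v r ≡ suc c →
    gödel k v ≡ sylvester (k + toℕ r) * gödel k (v [ r ]≔ c)
  gödel-dec k (_ ∷ v) zero {c} refl rewrite +-identityʳ k =
    *-assoc (sylvester k) (sylvester k ^ c) (gödel (suc k) v)
  gödel-dec k (x ∷ v) (suc r) {c} eq rewrite +-suc k (toℕ r) =
    trans (cong (sylvester k ^ x *_) (gödel-dec (suc k) v r eq))
          (*-leftComm (sylvester k ^ x) (sylvester (suc k + toℕ r)) (gödel (suc k) (v [ r ]≔ c)))

  coprime-gödel-< : ∀ {r} k {n} (v : Vec ℕ n) → r < k → Coprime (sylvester r) (gödel k v)
  coprime-gödel-< k []      r<k = Coprime.sym (1-coprimeTo _)
  coprime-gödel-< k (x ∷ v) r<k =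
    coprime-* (coprime-^ (sylvester-coprime-< r<k) x) (coprime-gödel-< (suc k) v (m<n⇒m<1+n r<k))

  -- The term of an empty register has exponent 0, and the other terms are coprime to it.
  coprime-gödel : ∀ k {n} (v : Vec ℕ n) r → lookup v r ≡ 0 → Coprime (sylvester (k + toℕ r)) (gödel k v)
  coprime-gödel k (_ ∷ v) zero refl rewrite +-identityʳ k =
    coprime-* (Coprime.sym (1-coprimeTo _)) (coprime-gödel-< (suc k) v ≤-refl)
  coprime-gödel k (x ∷ v) (suc r) eq rewrite +-suc k (toℕ r) =
    coprime-* (coprime-^ (Coprime.sym (sylvester-coprime-< (s≤s (m≤m+n k (toℕ r))))) x)
              (coprime-gödel (suc k) v r eq)

  gödel-∤ : ∀ k {n} (v : Vec ℕ n) r → lookup v r ≡ 0 → ¬ sylvester (k + toℕ r) ∣ gödel k v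
  gödel-∤ k v r eq s∣ = ≢-nonZero⁻¹ _ {{sylvesterProduct-nonZero (k + toℕ r)}}
    (suc-injective (coprime-gödel k v r eq (∣-refl , s∣)))

-- Register machines as counter programs

module Compiled (M : Machine 5) where

  open Machine M using (work; size; program; Answers)

  registers : ℕ
  registers = 7 + work

  -- Behind D and Y come the registers of M. Its inputs are the code C of the
  -- net, the index 1 of the starting node, the number X of its tokens, and the
  -- index 0 and the tokens 0 of free.
  vector : ℕ → ℕ → ℕ → ℕ → Vec ℕ registers
  vector i y C x = i ∷ y ∷ C ∷ 1 ∷ x ∷ 0 ∷ 0 ∷ replicate work 0

  -- A Gödel number cannot be one of its own registers, so `X` starts at 0 and is computed later.
  -- The second copy of `C`, in `D`, is a loop counter for this.
  start : ℕ → ℕ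
  start C = gödel 0 (vector C 0 C 0)

  growth : ℕ
  growth = sylvester 0 * sylvester 2

  -- Adding 1 to `C` increments registers 0 and 2, which multiplies the Gödel number by `growth`.
  -- Hence repeated multiplication can compute `start C`.
  start-power : ∀ C → start C ≡ start 0 * growth ^ C
  start-power zero    = sym (*-identityʳ (start 0))
  start-power (suc C) = begin
    start (suc C)
      ≡⟨ gödel-inc 0 (vector C 0 (suc C) 0) zero ⟩
    sylvester 0 * gödel 0 (vector C 0 (suc C) 0)
      ≡⟨ cong (sylvester 0 *_) (gödel-inc 0 (vector C 0 C 0) (suc (suc zero))) ⟩
    sylvester 0 * (sylvester 2 * start C)
      ≡⟨ *-assoc (sylvester 0) (sylvester 2) (start C) ⟨
    growth * start C
      ≡⟨ cong (growth *_) (start-power C) ⟩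
    growth * (start 0 * growth ^ C)
      ≡⟨ *-leftComm growth (start 0) (growth ^ C) ⟩
    start 0 * growth ^ suc C ∎
    where open ≡-Reasoning

  raise : ℕ → ℕ → ℕ
  raise r m = sylvester r ^ m

  -- Large enough for every constant of the program: the terms of the registers, and the factors
  -- that add `start 0` to register 4 and `growth` to register 1.
  K : ℕ
  K = sylvesterProduct registers + (raise 4 (start 0) + raise 1 growth)

  constant : ∀ {c} → c ≤ K → Fin (suc K)
  constant c≤K = fromℕ< (s≤s c≤K)

  sylvesterProduct≤K : (r : Fin registers) → sylvesterProduct (toℕ r) ≤ K
  sylvesterProduct≤K r = ≤-trans
    (∣⇒≤ {{sylvesterProduct-nonZero registers}} (sylvesterProduct-∣ (≤⇒≤′ (<⇒≤ (toℕ<n r)))))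
    (m≤m+n _ _)

  raise-4≤K : raise 4 (start 0) ≤ K
  raise-4≤K = ≤-trans (m≤m+n _ (raise 1 growth)) (m≤n+m _ (sylvesterProduct registers))

  raise-1≤K : raise 1 growth ≤ K
  raise-1≤K = ≤-trans (m≤n+m _ (raise 4 (start 0))) (m≤n+m _ (sylvesterProduct registers))

  single : Fin registers → Fin (suc K)
  single r = constant (sylvesterProduct≤K r)

  suc-single : ∀ r → suc (toℕ (single r)) ≡ sylvester (toℕ r)
  suc-single r = trans (cong suc (toℕ-fromℕ< (s≤s (sylvesterProduct≤K r)))) (sylvester-suc (toℕ r))

  power : ∀ r m → raise r m ≤ K → Fin (suc K)
  power r m ≤K = constant (≤-trans pred[n]≤n ≤K)

  suc-power : ∀ r m (≤K : raise r m ≤ K) → suc (toℕ (power r m ≤K)) ≡ raise r m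
  suc-power r m ≤K = trans (cong suc (toℕ-fromℕ< _))
    (suc-pred (raise r m) {{m^n≢0 (sylvester r) m {{sylvester-nonZero r}}}})

  pattern D = zero
  pattern Y = suc zero
  pattern X = suc (suc (suc (suc zero)))

  -- From start C = start 0 · growth ^ C with C in D, the preamble raises X to
  -- start 0 and multiplies it by growth, by way of Y, while counting down D.
  Λ₀ : Set
  Λ₀ = Fin 6 ⊎ Fin (suc size)

  pattern initial     = inj₁ zero
  pattern outer       = inj₁ (suc zero)
  pattern scale       = inj₁ (suc (suc zero))
  pattern scaling     = inj₁ (suc (suc (suc zero)))
  pattern move-back   = inj₁ (suc (suc (suc (suc zero))))
  pattern moving-back = inj₁ (suc (suc (suc (suc (suc zero)))))
  pattern main l      = inj₂ l

  compile : Instruction (5 + work) (suc size) → Command Λ₀ K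
  compile (halt b)       = halt b
  -- The registers of `M` are shifted past `D` and `Y`.
  compile (inc r l)      = mul (single (suc (suc r))) (main l)
  compile (dec r l₁ l₂)  = div (single (suc (suc r))) (main l₁) (main l₂)

  commands : Λ₀ → Command Λ₀ K
  commands initial     = mul (power 4 (start 0) raise-4≤K) outer
  commands outer       = div (single D) scale (main zero)
  commands scale       = div (single X) scaling move-back
  commands scaling     = mul (power 1 growth raise-1≤K) scale
  commands move-back   = div (single Y) moving-back outer
  commands moving-back = mul (single X) move-back
  commands (main l)    = compile (lookup program l)

  open CounterProgram commands public

  _∙_↓_ : Λ₀ → Vec ℕ registers → Bool → Set
  l ∙ v ↓ b = l , gödel 0 v ↓ b

  run-inc : ∀ {l l₁ r v b} → commands l ≡ mul (single r) l₁ →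
            l₁ ∙ v [ r ]%= suc ↓ b → l ∙ v ↓ b
  run-inc {l₁ = l₁} {r} {v} {b} eq run = mul eq (subst (λ n → l₁ , n ↓ b)
    (trans (gödel-inc 0 v r) (cong (_* gödel 0 v) (sym (suc-single r)))) run)

  run-dec-suc : ∀ {l l₁ l₂ r v b c} → commands l ≡ div (single r) l₁ l₂ →
                lookup v r ≡ suc c → l₁ ∙ v [ r ]≔ c ↓ b → l ∙ v ↓ b
  run-dec-suc {r = r} {v} {c = c} eq v≡ run = div-yes eq
    (trans (gödel-dec 0 v r v≡) (cong (_* gödel 0 (v [ r ]≔ c)) (sym (suc-single r)))) run

  run-dec-zero : ∀ {l l₁ l₂ r v b} → commands l ≡ div (single r) l₁ l₂ →
                 lookup v r ≡ 0 → l₂ ∙ v ↓ b → l ∙ v ↓ b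
  run-dec-zero {r = r} {v} eq v≡ run = div-no eq
    (λ d∣ → gödel-∤ 0 v r v≡ (subst (_∣ gödel 0 v) (suc-single r) d∣)) run

  run-add : ∀ {l l₁ m v b} r (≤K : raise (toℕ r) m ≤ K) → commands l ≡ mul (power (toℕ r) m ≤K) l₁ →
            l₁ ∙ v [ r ]%= (m +_) ↓ b → l ∙ v ↓ b
  run-add {l₁ = l₁} {m} {v} {b} r ≤K eq run = mul eq (subst (λ n → l₁ , n ↓ b)
    (trans (gödel-add 0 v r m) (cong (_* gödel 0 v) (sym (suc-power (toℕ r) m ≤K)))) run)

  run-main : ∀ {l v b} → program ⊢ l , v ⇓ b → main l ∙ 0 ∷ 0 ∷ v ↓ b
  run-main (halt eq) = halt (cong compile eq)
  run-main {v = v} (inc eq run) = run-inc {v = 0 ∷ 0 ∷ v} (cong compile eq) (run-main run)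
  run-main {v = v} (dec-suc eq v≡ run) = run-dec-suc {v = 0 ∷ 0 ∷ v} (cong compile eq) v≡ (run-main run)
  run-main {v = v} (dec-zero eq v≡ run) = run-dec-zero {v = 0 ∷ 0 ∷ v} (cong compile eq) v≡ (run-main run)

  -- Runs of the preamble

  module _ {C : ℕ} {b : Bool} where

    -- As `↓` speaks of complete runs only, each loop is put in front of a run from its exit.
    run-move-back : ∀ i y x → outer ∙ vector i 0 C (y + x) ↓ b → move-back ∙ vector i y C x ↓ b
    run-move-back i zero    x run = run-dec-zero {v = vector i 0 C x} refl refl run
    run-move-back i (suc y) x run = run-dec-suc {v = vector i (suc y) C x} refl refl
      (run-inc {v = vector i y C x} refl
        (run-move-back i y (suc x)
          (subst (λ z → outer ∙ vector i 0 C z ↓ b) (sym (+-suc y x)) run)))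

    run-scale : ∀ i x y → move-back ∙ vector i (x * growth + y) C 0 ↓ b → scale ∙ vector i y C x ↓ b
    run-scale i zero    y run = run-dec-zero {v = vector i y C 0} refl refl run
    run-scale i (suc x) y run = run-dec-suc {v = vector i y C (suc x)} refl refl
      (run-add {v = vector i y C x} Y raise-1≤K refl
        (run-scale i x (growth + y)
          (subst (λ z → move-back ∙ vector i z C 0 ↓ b) (reassociate growth (x * growth) y) run)))
      where
      reassociate : ∀ g p y → g + p + y ≡ p + (g + y)
      reassociate = solve-∀

    run-outer : ∀ i x → main zero ∙ vector 0 0 C (x * growth ^ i) ↓ b → outer ∙ vector i 0 C x ↓ b
    run-outer zero x run = run-dec-zero {v = vector 0 0 C x} refl refl
      (subst (λ z → main zero ∙ vector 0 0 C z ↓ b) (*-identityʳ x) run)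
    run-outer (suc i) x run = run-dec-suc {v = vector (suc i) 0 C x} refl refl
      (run-scale i x 0 (run-move-back i (x * growth + 0) 0
        (subst (λ z → outer ∙ vector i 0 C z ↓ b) (sym (trans (+-identityʳ _) (+-identityʳ _)))
          (run-outer i (x * growth)
            (subst (λ z → main zero ∙ vector 0 0 C z ↓ b) (sym (*-assoc x growth (growth ^ i))) run)))))

  -- The preamble ends with `start C` in `X` and with `D` and `Y` empty, so `M` starts with an input
  -- that contains the initial counter value itself.
  run-initial : ∀ {C b} → Answers (C ∷ 1 ∷ start C ∷ 0 ∷ 0 ∷ []) b → initial , start C ↓ b
  run-initial {C} {b} run = run-add {v = vector C 0 C 0} X raise-4≤K refl
    (run-outer C (start 0 + 0)
      (subst (λ x → main zero ∙ vector 0 0 C x ↓ b)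
        (trans (start-power C) (cong (_* growth ^ C) (sym (+-identityʳ (start 0)))))
        (run-main run)))

  -- The net of the compiled program

  Λ-finite : Finite Λ⁺
  Λ-finite = finite-⊎ (finite-⊎ finite-Fin finite-Fin)
                      (finite-× finite-Fin (finite-× finite-Fin (finite-⊎ finite-Fin finite-Fin)))

  node-finite : Finite (Node Λ⁺ K)
  node-finite = finite-Node Λ-finite

  open Game (proj₂ Λ-finite) (proj₂ node-finite) lines public

  -- Their indices compute to 1 and 0, as `vector` presumes: anchors come first in `finite-Node`,
  -- `nothing` in `finite-Maybe`, and `initial` in `Λ⁺`.
  origin goal : State N
  origin = Inverse.to (proj₂ node-finite) (at (base initial))
  goal   = Inverse.to (proj₂ node-finite) free

  rejected : ∀ C → Answers (C ∷ 1 ∷ start C ∷ 0 ∷ 0 ∷ []) true →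
             ¬ WeaklyBisimilar N (origin X^ start C) (goal X^ 0)
  rejected C answers (_ , bisim , PQ) = distinguished
    (rejects-lost (proj₂ Λ-finite) (proj₂ node-finite) (run-initial answers)) bisim 0 PQ

  accepted : ∀ C → Answers (C ∷ 1 ∷ start C ∷ 0 ∷ 0 ∷ []) false →
             BranchingBisimilar N (origin X^ start C) (goal X^ 0)
  accepted C answers = Bisimilar.bisimilar Accepts
    (λ {l} {n} → accepts-advances {l} {n}) {base initial} (run-initial answers)

-- The diagonal argument

diagonalise : ∀ {r : Level} (R : (N : Net) → Rel (Process N) r) →
  (∀ N → BranchingBisimilar N ⇒ R N) →
  (∀ N → R N ⇒ WeaklyBisimilar N) →
  (M : Machine 5) (N : Net) → Normed N → (p q : State N) (start : ℕ → ℕ) →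
  (∀ C → Machine.Answers M (C ∷ toℕ p ∷ start C ∷ toℕ q ∷ 0 ∷ []) true →
    ¬ WeaklyBisimilar N (p X^ start C) (q X^ 0)) →
  (∀ C → Machine.Answers M (C ∷ toℕ p ∷ start C ∷ toℕ q ∷ 0 ∷ []) false →
    BranchingBisimilar N (p X^ start C) (q X^ 0)) →
  ¬ (∀ x → ∃[ b ] (Machine.Answers M (encodeInstance x) b ×
                   Reflects (R (Instance.N x) (Instance.P x) (Instance.Q x)) b))
diagonalise R lower upper M N normed p q start rejected accepted decides
  -- With `C` the code of `N` itself, the hypotheses concern the very instance that `M` is asked
  -- about, and either answer is wrong.
  with decides ⟨ N , normed , p X^ start (codeNet N) , q X^ 0 ⟩
... | true  , answers , ofʸ related   = rejected (codeNet N) answers (upper N related)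
... | false , answers , ofⁿ unrelated = unrelated (lower N (accepted (codeNet N) answers))

theorem1 : ∀ {r : Level} (R : (N : Net) → Rel (Process N) r) →
    (∀ N → BranchingBisimilar N ⇒ R N) →
    (∀ N → R N ⇒ WeaklyBisimilar N) →
    ¬ AlgorithmicallyDecidable encodeInstance (λ x → R (Instance.N x) (Instance.P x) (Instance.Q x))
theorem1 R lower upper (M , decides) =
  diagonalise R lower upper M N N-normed origin goal start rejected accepted decides
  where open Compiled M
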